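{- Let $S_9=(s_0,s_1,\dots,s_{23})$ be the sequence $$(8,8,6,6,4,4,\ 8,8,6,6,4,4,\ 4,4,2,2,0,0,\ 4,4,2,2,0,0).$$ Let $\varphi_9:\mathbb{N}\to\mathbb{N}$ be the function defined as follows. The values $\varphi_9(0),\varphi_9(1),\dots,\varphi_9(63)$ are, in order (ten per row), $$\begin{array}{l}7,6,9,8,11,10,1,0,3,2,\\ 5,4,17,16,23,22,13,12,21,20,\\ 19,18,15,14,31,30,33,32,35,34,\\ 25,24,27,26,29,28,41,40,45,44,\\ 37,36,49,48,39,38,53,52,43,42,\\ 57,56,47,46,61,60,51,50,63,62,\\ 55,54,59,58,\end{array}$$ and for $x\ge 64$, $$\varphi_9(x)=x\oplus_{s_{x-64}}7=\bigl((x+s_{x-64})\oplus 7\bigr)-s_{x-64},$$ where the index $x-64$ is taken modulo $24$. Then, for all nonnegative integers $a,b$, the Halve Nim position $a^1b^19^1$ is a $\mathcal{P}$-position if and only if $b=\varphi_9(a)$.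
   Context: $\mathbb{N}$ is the set of nonnegative integers and $\oplus$ denotes bitwise XOR. The $n$-shifted bitwise sum, for an integer $n$, is $x\oplus_n y=\bigl((x+n)\oplus y\bigr)-n$. Halve Nim is a two-player game played on finitely many piles of coins; players alternate moves and a player who cannot move loses. A move is one of: (i) choose one pile and remove at least one coin from it; (ii) halve the game: simultaneously replace every pile of $m$ coins by a pile of $\lfloor m/2\rfloor$ coins. When there are no coins left, no move is available (halving requires at least one coin to be present). A position is a $\mathcal{P}$-position if the player who is not about to move has a winning strategy (equivalently, every move from it leads to an $\mathcal{N}$-position), and an $\mathcal{N}$-position if the player about to move has a winning strategy. $a^1b^1c^1$ denotes the position with three piles of sizes $a$, $b$, $c$ (a pile of size $0$ is an empty pile); in particular $a^1b^19^1$ has piles of sizes $a$, $b$, $9$. -}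

module Defs where

open import Data.Nat.Base
open import Data.Nat.Properties
open import Data.Nat.DivMod using (_/_; _%_; _mod_; m≡m%n+[m/n]*n; m%n<n; m/n<m)
open import Data.Nat.Solver using (module +-*-Solver)
open import Data.List.Base using (List; []; _∷_; map)
open import Data.List.Relation.Unary.Any using (Any)
open import Data.Fin.Base using (fromℕ<)
open import Data.Vec.Base using (Vec; []; _∷_; lookup)
open import Relation.Binary.PropositionalEquality using (_≡_; refl; cong)
open import Relation.Nullary.Decidable.Core using (yes; no)

Position : Set
Position = List ℕ

infix 4 _⟶ᵖ_ _⟶_

data _⟶ᵖ_ : Position → Position → Set where
  here  : ∀ {m n ps} → m < n → n ∷ ps ⟶ᵖ m ∷ ps
  there : ∀ {n ps qs} → ps ⟶ᵖ qs → n ∷ ps ⟶ᵖ n ∷ qs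

data _⟶_ : Position → Position → Set where
  remove : ∀ {ps qs} → ps ⟶ᵖ qs → ps ⟶ qs
  halve  : ∀ {ps} → Any (0 <_) ps → ps ⟶ map ⌊_/2⌋ ps

-- The types are inductive, so an element is a well-founded winning strategy:
-- 𝒩 for the player about to move, 𝒫 for the other player.
mutual
  data 𝒫-position (ps : Position) : Set where
    every-move : (∀ {qs} → ps ⟶ qs → 𝒩-position qs) → 𝒫-position ps

  data 𝒩-position (ps : Position) : Set where
    some-move : ∀ {qs} → ps ⟶ qs → 𝒫-position qs → 𝒩-position ps

-- XOR of the k lowest binary digits of x and y.
xorDigits : (k x y : ℕ) → ℕ
xorDigits zero    x y = 0
xorDigits (suc k) x y = (x % 2 + y % 2) % 2 + 2 * xorDigits k (x / 2) (y / 2)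

infixl 6 _⊕_ _⊕[_]_

-- Neither x nor y has more than x + y binary digits.
_⊕_ : ℕ → ℕ → ℕ
x ⊕ y = xorDigits (x + y) x y

-- Only natural shifts n are needed.  The subtraction is truncated; by
-- ⊕[]-exact below this is harmless whenever y ≤ x, as it is in φ₉.
_⊕[_]_ : ℕ → ℕ → ℕ → ℕ
x ⊕[ n ] y = ((x + n) ⊕ y) ∸ n

S₉ : Vec ℕ 24
S₉ = 8 ∷ 8 ∷ 6 ∷ 6 ∷ 4 ∷ 4 ∷ 8 ∷ 8 ∷ 6 ∷ 6 ∷ 4 ∷ 4 ∷
     4 ∷ 4 ∷ 2 ∷ 2 ∷ 0 ∷ 0 ∷ 4 ∷ 4 ∷ 2 ∷ 2 ∷ 0 ∷ 0 ∷ []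

initial₉ : Vec ℕ 64
initial₉ =
   7 ∷  6 ∷  9 ∷  8 ∷ 11 ∷ 10 ∷  1 ∷  0 ∷  3 ∷  2 ∷
   5 ∷  4 ∷ 17 ∷ 16 ∷ 23 ∷ 22 ∷ 13 ∷ 12 ∷ 21 ∷ 20 ∷
  19 ∷ 18 ∷ 15 ∷ 14 ∷ 31 ∷ 30 ∷ 33 ∷ 32 ∷ 35 ∷ 34 ∷
  25 ∷ 24 ∷ 27 ∷ 26 ∷ 29 ∷ 28 ∷ 41 ∷ 40 ∷ 45 ∷ 44 ∷
  37 ∷ 36 ∷ 49 ∷ 48 ∷ 39 ∷ 38 ∷ 53 ∷ 52 ∷ 43 ∷ 42 ∷
  57 ∷ 56 ∷ 47 ∷ 46 ∷ 61 ∷ 60 ∷ 51 ∷ 50 ∷ 63 ∷ 62 ∷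
  55 ∷ 54 ∷ 59 ∷ 58 ∷ []

φ₉ : ℕ → ℕ
φ₉ x with x <? 64
... | yes x<64 = lookup initial₉ (fromℕ< x<64)
... | no  _    = x ⊕[ lookup S₉ ((x ∸ 64) mod 24) ] 7

private
  digit-bound : ∀ r s → r < 2 → s < 2 → r ≤ (r + s) % 2 + s
  digit-bound 0 s _ _ = z≤n
  digit-bound 1 0 _ _ = s≤s z≤n
  digit-bound 1 1 _ _ = s≤s z≤n
  digit-bound 1 (suc (suc s)) _ (s≤s (s≤s ()))
  digit-bound (suc (suc r)) s (s≤s (s≤s ())) _

  xorDigits-bound : ∀ k x y → x ≤ k → x ≤ xorDigits k x y + y
  xorDigits-bound k       zero      y x≤k = z≤n
  xorDigits-bound (suc k) x@(suc _) y x≤k = begin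
    x                                        ≡⟨ m≡m%n+[m/n]*n x 2 ⟩
    x % 2 + x / 2 * 2                        ≤⟨ +-mono-≤ low (*-monoˡ-≤ 2 high) ⟩
    (d + y % 2) + (e + y / 2) * 2            ≡⟨ rearrange d (y % 2) e (y / 2) ⟩
    (d + 2 * e) + (y % 2 + y / 2 * 2)        ≡⟨ cong (d + 2 * e +_) (m≡m%n+[m/n]*n y 2) ⟨
    (d + 2 * e) + y                          ∎
    where
    open ≤-Reasoning
    d e : ℕ
    d = (x % 2 + y % 2) % 2
    e = xorDigits k (x / 2) (y / 2)
    low : x % 2 ≤ d + y % 2
    low = digit-bound (x % 2) (y % 2) (m%n<n x 2) (m%n<n y 2)
    high : x / 2 ≤ e + y / 2
    high = xorDigits-bound k (x / 2) (y / 2)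
             (≤-pred (≤-trans (m/n<m x 2 (s≤s (s≤s z≤n))) x≤k))
    rearrange : ∀ d b e h → (d + b) + (e + h) * 2 ≡ (d + 2 * e) + (b + h * 2)
    rearrange = solve 4 (λ d b e h →
      (d :+ b) :+ (e :+ h) :* con 2 := (d :+ con 2 :* e) :+ (b :+ h :* con 2)) refl
      where open +-*-Solver

⊕[]-exact : ∀ {x y} n → y ≤ x → x ⊕[ n ] y + n ≡ (x + n) ⊕ y
⊕[]-exact {x} {y} n y≤x = m∸n+n≡m (+-cancelʳ-≤ y n ((x + n) ⊕ y) (begin
  n + y             ≡⟨ +-comm n y ⟩
  y + n             ≤⟨ +-monoˡ-≤ n y≤x ⟩
  x + n             ≤⟨ xorDigits-bound (x + n + y) (x + n) y (m≤m+n (x + n) y) ⟩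
  (x + n) ⊕ y + y   ∎))
  where open ≤-Reasoning

-- For each third pile c < 10 the 𝒫-positions (a, b, c) are the graph of an
-- involution φ c.  Beyond a short irregular prefix, φ c permutes consecutive
-- blocks of 4, 8 or 12 numbers, always by the same permutation — except that for
-- c < 4 there are two permutations, used alternately on the intervals
-- [28·2ᵏ, 28·2ᵏ⁺¹), so that halving exchanges them.  That the graphs form
-- the kernel of the game is a local condition, since φ c moves numbers by at most
-- 9, and it is invariant under a ↦ a + 48 (a ↦ a + 24 after halving); so
-- finitely many cases suffice.

{-# OPTIONS --safe #-}
module Submission where

open import Defs
open import Data.Bool.Base using (Bool; true; false; not)
open import Data.Bool.Properties using (not-involutive)
open import Data.Empty using (⊥)
open import Data.Fin.Properties using (fromℕ<-cong)
open import Data.List.Base using (List; []; _∷_; length; map)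
open import Data.List.NonEmpty.Base as List⁺ using (List⁺; _∷_; toList)
open import Data.List.Relation.Unary.Any using (Any; here; there; any?)
open import Data.Nat.Base
open import Data.Nat.DivMod
open import Data.Nat.Divisibility using (_∣_; _∣?_; m∣m*n; divides; divides-refl; ∣-trans)
open import Data.Nat.Induction using (<-rec)
open import Data.Nat.ListAction using (sum)
open import Data.Nat.Logarithm using (⌈log₂_⌉; ⌈log₂⌉-mono-≤; ⌈log₂⌈n/2⌉⌉≡⌈log₂n⌉∸1)
open import Data.Nat.Properties
open import Data.Nat.Solver using (module +-*-Solver)
open import Data.Product.Base using (_×_; _,_; ∃; proj₁; proj₂)
open import Data.Sum.Base using (_⊎_; inj₁; inj₂)
open import Data.Vec.Base using (lookup)
open import Function.Base using (case_of_)
open import Function.Bundles using (_⇔_; mk⇔)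
open import Relation.Binary.Definitions using (tri<; tri≈; tri>)
open import Relation.Binary.PropositionalEquality
open import Relation.Nullary.Decidable using (Dec; yes; no; map′; from-yes; ¬?; _×-dec_; _⊎-dec_; _→-dec_)
open import Relation.Nullary.Negation.Core using (contradiction)

-- Explicit partner functions.

odd : ℕ → Bool
odd zero    = false
odd (suc n) = not (odd n)

-- For x ≥ 28 this is the parity of the k with 28·2ᵏ⁻¹ ≤ x < 28·2ᵏ.
phase : ℕ → Bool
phase x = odd ⌈log₂ suc (x / 28) ⌉

prefix : ℕ → List ℕ
prefix 0 =
  0 ∷ 2 ∷ 1 ∷ 3 ∷ 4 ∷ 5 ∷ 8 ∷ 9 ∷ 6 ∷ 7 ∷ 12 ∷ 13 ∷ 10 ∷ 11 ∷ 14 ∷ 15 ∷ 16 ∷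
  17 ∷ 18 ∷ 19 ∷ 20 ∷ 21 ∷ 22 ∷ 23 ∷ 24 ∷ 25 ∷ 26 ∷ 27 ∷ 30 ∷ 31 ∷ 28 ∷ 29 ∷
  []
prefix 1 =
  2 ∷ 3 ∷ 0 ∷ 1 ∷ 5 ∷ 4 ∷ 9 ∷ 8 ∷ 7 ∷ 6 ∷ 13 ∷ 12 ∷ 11 ∷ 10 ∷ 15 ∷ 14 ∷ 17 ∷
  16 ∷ 19 ∷ 18 ∷ 21 ∷ 20 ∷ 23 ∷ 22 ∷ 25 ∷ 24 ∷ 27 ∷ 26 ∷ 31 ∷ 30 ∷ 29 ∷ 28 ∷
  []
prefix 2 =
  1 ∷ 0 ∷ 2 ∷ 4 ∷ 3 ∷ 6 ∷ 5 ∷ 7 ∷ 8 ∷ 9 ∷ 10 ∷ 11 ∷ 12 ∷ 13 ∷ 18 ∷ 19 ∷ 20 ∷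
  21 ∷ 14 ∷ 15 ∷ 16 ∷ 17 ∷ 26 ∷ 27 ∷ 28 ∷ 29 ∷ 22 ∷ 23 ∷ 24 ∷ 25 ∷ 30 ∷ 31 ∷
  []
prefix 3 =
  3 ∷ 1 ∷ 4 ∷ 0 ∷ 2 ∷ 7 ∷ 6 ∷ 5 ∷ 9 ∷ 8 ∷ 11 ∷ 10 ∷ 13 ∷ 12 ∷ 19 ∷ 18 ∷ 21 ∷
  20 ∷ 15 ∷ 14 ∷ 17 ∷ 16 ∷ 27 ∷ 26 ∷ 29 ∷ 28 ∷ 23 ∷ 22 ∷ 25 ∷ 24 ∷ 31 ∷ 30 ∷
  []
prefix 4 =
  4 ∷ 5 ∷ 3 ∷ 2 ∷ 0 ∷ 1 ∷ 7 ∷ 6 ∷ 10 ∷ 11 ∷ 8 ∷ 9 ∷ 14 ∷ 15 ∷ 12 ∷ 13 ∷ 18 ∷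
  19 ∷ 16 ∷ 17 ∷ 22 ∷ 23 ∷ 20 ∷ 21 ∷ 26 ∷ 27 ∷ 24 ∷ 25 ∷ 28 ∷ 29 ∷ []
prefix 5 =
  5 ∷ 4 ∷ 6 ∷ 7 ∷ 1 ∷ 0 ∷ 2 ∷ 3 ∷ 11 ∷ 10 ∷ 9 ∷ 8 ∷ 15 ∷ 14 ∷ 13 ∷ 12 ∷ 19 ∷
  18 ∷ 17 ∷ 16 ∷ 23 ∷ 22 ∷ 21 ∷ 20 ∷ 27 ∷ 26 ∷ 25 ∷ 24 ∷ 29 ∷ 28 ∷ []
prefix 6 =
  8 ∷ 9 ∷ 5 ∷ 6 ∷ 7 ∷ 2 ∷ 3 ∷ 4 ∷ 0 ∷ 1 ∷ 16 ∷ 17 ∷ 18 ∷ 19 ∷ 20 ∷ 21 ∷ 10 ∷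
  11 ∷ 12 ∷ 13 ∷ 14 ∷ 15 ∷ 24 ∷ 25 ∷ 22 ∷ 23 ∷ 28 ∷ 29 ∷ 26 ∷ 27 ∷ []
prefix 7 =
  9 ∷ 8 ∷ 7 ∷ 5 ∷ 6 ∷ 3 ∷ 4 ∷ 2 ∷ 1 ∷ 0 ∷ 17 ∷ 16 ∷ 19 ∷ 18 ∷ 21 ∷ 20 ∷ 11 ∷
  10 ∷ 13 ∷ 12 ∷ 15 ∷ 14 ∷ 25 ∷ 24 ∷ 23 ∷ 22 ∷ 29 ∷ 28 ∷ 27 ∷ 26 ∷ []
prefix 8 =
  6 ∷ 7 ∷ 8 ∷ 9 ∷ 10 ∷ 11 ∷ 0 ∷ 1 ∷ 2 ∷ 3 ∷ 4 ∷ 5 ∷ 16 ∷ 17 ∷ 22 ∷ 23 ∷ 12 ∷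
  13 ∷ 20 ∷ 21 ∷ 18 ∷ 19 ∷ 14 ∷ 15 ∷ 30 ∷ 31 ∷ 32 ∷ 33 ∷ 34 ∷ 35 ∷ 24 ∷ 25 ∷
  26 ∷ 27 ∷ 28 ∷ 29 ∷ 40 ∷ 41 ∷ 44 ∷ 45 ∷ 36 ∷ 37 ∷ 48 ∷ 49 ∷ 38 ∷ 39 ∷ 52 ∷
  53 ∷ 42 ∷ 43 ∷ 56 ∷ 57 ∷ 46 ∷ 47 ∷ 60 ∷ 61 ∷ 50 ∷ 51 ∷ 62 ∷ 63 ∷ 54 ∷ 55 ∷
  58 ∷ 59 ∷ []
prefix 9 =
  7 ∷ 6 ∷ 9 ∷ 8 ∷ 11 ∷ 10 ∷ 1 ∷ 0 ∷ 3 ∷ 2 ∷ 5 ∷ 4 ∷ 17 ∷ 16 ∷ 23 ∷ 22 ∷ 13 ∷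
  12 ∷ 21 ∷ 20 ∷ 19 ∷ 18 ∷ 15 ∷ 14 ∷ 31 ∷ 30 ∷ 33 ∷ 32 ∷ 35 ∷ 34 ∷ 25 ∷ 24 ∷
  27 ∷ 26 ∷ 29 ∷ 28 ∷ 41 ∷ 40 ∷ 45 ∷ 44 ∷ 37 ∷ 36 ∷ 49 ∷ 48 ∷ 39 ∷ 38 ∷ 53 ∷
  52 ∷ 43 ∷ 42 ∷ 57 ∷ 56 ∷ 47 ∷ 46 ∷ 61 ∷ 60 ∷ 51 ∷ 50 ∷ 63 ∷ 62 ∷ 55 ∷ 54 ∷
  59 ∷ 58 ∷ []
prefix _ = []

block : ℕ → Bool → List⁺ ℕ
block 0 true  = 2 ∷ 3 ∷ 0 ∷ 1 ∷ []
block 0 false = 0 ∷ 1 ∷ 2 ∷ 3 ∷ []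
block 1 true  = 3 ∷ 2 ∷ 1 ∷ 0 ∷ []
block 1 false = 1 ∷ 0 ∷ 3 ∷ 2 ∷ []
block 2 true  = 0 ∷ 1 ∷ 2 ∷ 3 ∷ []
block 2 false = 2 ∷ 3 ∷ 0 ∷ 1 ∷ []
block 3 true  = 1 ∷ 0 ∷ 3 ∷ 2 ∷ []
block 3 false = 3 ∷ 2 ∷ 1 ∷ 0 ∷ []
block 4 _     = 2 ∷ 3 ∷ 0 ∷ 1 ∷ []
block 5 _     = 3 ∷ 2 ∷ 1 ∷ 0 ∷ []
block 6 _     = 4 ∷ 5 ∷ 6 ∷ 7 ∷ 0 ∷ 1 ∷ 2 ∷ 3 ∷ []
block 7 _     = 5 ∷ 4 ∷ 7 ∷ 6 ∷ 1 ∷ 0 ∷ 3 ∷ 2 ∷ []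
block 8 _     = 6 ∷ 7 ∷ 8 ∷ 9 ∷ 10 ∷ 11 ∷ 0 ∷ 1 ∷ 2 ∷ 3 ∷ 4 ∷ 5 ∷ []
block 9 _     = 7 ∷ 6 ∷ 9 ∷ 8 ∷ 11 ∷ 10 ∷ 1 ∷ 0 ∷ 3 ∷ 2 ∷ 5 ∷ 4 ∷ []
block _ _     = 0 ∷ []

-- Out of range, the value is 0.
infixl 9 _!_
_!_ : List ℕ → ℕ → ℕ
[]       ! _     = 0
(x ∷ xs) ! zero  = x
(x ∷ xs) ! suc n = xs ! n

-- The values ps on [0, length ps), followed by translated copies of the
-- permutation bs.
extend : List ℕ → List⁺ ℕ → ℕ → ℕ
extend ps bs x with x <? length ps
... | yes _ = ps ! x
... | no  _ = x ∸ r + toList bs ! r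
  where r = (x ∸ length ps) % List⁺.length bs

partner : Bool → ℕ → ℕ → ℕ
partner τ c = extend (prefix c) (block c τ)

φ : ℕ → ℕ → ℕ
φ c x = partner (phase x) c x

-- Local kernel conditions and their finite checks.

Absorbed : (f g : ℕ → ℕ → ℕ) (c a b : ℕ) → Set
Absorbed f g c a b = (∃ λ c′ → c′ < c × f c′ a ≡ b) ⊎ ⌊ b /2⌋ ≡ g ⌊ c /2⌋ ⌊ a /2⌋

all<? : ∀ {p} {P : ℕ → Set p} → (∀ n → Dec (P n)) → ∀ v → Dec (∀ n → n < v → P n)
all<? P? v = map′ (λ p n → p {n}) (λ p {n} → p n) (allUpTo? P? v)

allBool? : ∀ {p} {P : Bool → Set p} → (∀ τ → Dec (P τ)) → Dec (∀ τ → P τ)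
allBool? P? = map′ (λ (pt , pf) → λ where
                      true  → pt
                      false → pf)
                   (λ p → p true , p false)
                   (P? true ×-dec P? false)

-- f is used on the piles as they are and g after halving, because for large
-- piles these are different branches of φ.  In the last field b = 9 + a ∸ d
-- runs over [a ∸ 9, a + 9], outside of which the two inequalities fail.
record Kernel (f g : ℕ → ℕ → ℕ) (c a : ℕ) : Set where
  constructor kernel
  field
    involutive : f c (f c a) ≡ a
    distinct   : ∀ c′ → c′ < c → f c′ a ≢ f c a
    unhalved   : Any (0 <_) (a ∷ f c a ∷ c ∷ []) → ⌊ f c a /2⌋ ≢ g ⌊ c /2⌋ ⌊ a /2⌋
    absorbing  : ∀ d → d < 19 → 9 + a ∸ d < f c a → a < f c (9 + a ∸ d) →
                 Absorbed f g c a (9 + a ∸ d)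

Kernel? : ∀ f g c a → Dec (Kernel f g c a)
Kernel? f g c a = map′ (λ (i , d , u , s) → kernel i d u s)
                       (λ (kernel i d u s) → i , d , u , s)
  (  f c (f c a) ≟ a
  ×-dec all<? (λ c′ → ¬? (f c′ a ≟ f c a)) c
  ×-dec (any? (0 <?_) (a ∷ f c a ∷ c ∷ []) →-dec ¬? (⌊ f c a /2⌋ ≟ g ⌊ c /2⌋ ⌊ a /2⌋))
  ×-dec all<? (λ d → 9 + a ∸ d <? f c a →-dec (a <? f c (9 + a ∸ d) →-dec
          (anyUpTo? (λ c′ → f c′ a ≟ 9 + a ∸ d) c ⊎-dec ⌊ 9 + a ∸ d /2⌋ ≟ g ⌊ c /2⌋ ⌊ a /2⌋))) 19)

-- From `80 ≤ a` on, every number within 9 of `a` is at least 71, past all prefixes (length at most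
-- 64), and `⌊ a /2⌋` is past the prefixes met after halving (length at most 32). Only smaller `a`
-- need individual checks.
initial-kernel : ∀ c → c < 10 → ∀ a → a < 80 → Kernel φ φ c a
initial-kernel = from-yes (all<? (λ c → all<? (λ a → Kernel? φ φ c a) 80) 10)

periodic-kernel : ∀ c → c < 10 → ∀ i → i < 48 → ∀ τ →
  Kernel (partner τ) (partner (not τ)) c (80 + i)
periodic-kernel = from-yes (all<? (λ c → all<? (λ i → allBool? (λ τ →
  Kernel? (partner τ) (partner (not τ)) c (80 + i))) 48) 10)

open Kernel

-- Periodicity beyond the prefixes.

extend-shift : ∀ ps bs {n x} → List⁺.length bs ∣ n → length ps ≤ x →
               extend ps bs (n + x) ≡ n + extend ps bs x
extend-shift ps bs {n} {x} p∣n ps≤x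
  with n + x <? length ps | x <? length ps
... | yes n+x< | _      = contradiction (≤-trans ps≤x (m≤n+m x n)) (<⇒≱ n+x<)
... | no _     | yes x< = contradiction ps≤x (<⇒≱ x<)
... | no _     | no _   = begin
  n + x ∸ r′ + toList bs ! r′     ≡⟨ cong (λ i → n + x ∸ i + toList bs ! i) r′≡r ⟩
  n + x ∸ r + toList bs ! r       ≡⟨ cong (_+ toList bs ! r) (+-∸-assoc n r≤x) ⟩
  n + (x ∸ r) + toList bs ! r     ≡⟨ +-assoc n (x ∸ r) _ ⟩
  n + (x ∸ r + toList bs ! r)     ∎
  where
  open ≡-Reasoning
  r r′ : ℕ
  r  = (x ∸ length ps) % List⁺.length bs
  r′ = (n + x ∸ length ps) % List⁺.length bs
  r′≡r : r′ ≡ r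
  r′≡r = trans (%-congˡ {o = List⁺.length bs} (+-∸-assoc n ps≤x)) (%-remove-+ˡ (x ∸ length ps) p∣n)
  r≤x : r ≤ x
  r≤x = ≤-trans (m%n≤m (x ∸ length ps) (List⁺.length bs)) (m∸n≤m x (length ps))

-- 24 is the least common multiple of the block lengths 4, 8 and 12; doubling it gives a period that
-- survives halving.
period∣24 : ∀ c → c < 10 → ∀ τ → List⁺.length (block c τ) ∣ 24
period∣24 = from-yes (all<? (λ c → allBool? (λ τ → List⁺.length (block c τ) ∣? 24)) 10)

prefix≤64 : ∀ c → c < 10 → length (prefix c) ≤ 64
prefix≤64 = from-yes (all<? (λ c → length (prefix c) ≤? 64) 10)

prefix-half≤32 : ∀ c → c < 10 → length (prefix ⌊ c /2⌋) ≤ 32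
prefix-half≤32 = from-yes (all<? (λ c → length (prefix ⌊ c /2⌋) ≤? 32) 10)

⌊c/2⌋<10 : ∀ {c} → c < 10 → ⌊ c /2⌋ < 10
⌊c/2⌋<10 {c} = ≤-<-trans (⌊n/2⌋≤n c)

partner-shift : ∀ τ c → c < 10 → ∀ x → 64 ≤ x → partner τ c (48 + x) ≡ 48 + partner τ c x
partner-shift τ c c<10 x 64≤x =
  trans (shift24 (24 + x) (m≤n⇒m≤o+n 24 64≤x)) (cong (24 +_) (shift24 x 64≤x))
  where
  shift24 : ∀ y → 64 ≤ y → partner τ c (24 + y) ≡ 24 + partner τ c y
  shift24 y 64≤y = extend-shift (prefix c) (block c τ) (period∣24 c c<10 τ)
                     (≤-trans (prefix≤64 c c<10) 64≤y)

partner-half-shift : ∀ τ c → c < 10 → ∀ x → 32 ≤ x →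
                     partner τ ⌊ c /2⌋ (24 + x) ≡ 24 + partner τ ⌊ c /2⌋ x
partner-half-shift τ c c<10 x 32≤x =
  extend-shift (prefix ⌊ c /2⌋) (block ⌊ c /2⌋ τ) (period∣24 ⌊ c /2⌋ (⌊c/2⌋<10 c<10) τ)
    (≤-trans (prefix-half≤32 c c<10) 32≤x)

-- The threshold `m` is there because the shift laws hold only past the prefixes.
period-induction-from : ∀ {p} (P : ℕ → Set p) m → (∀ i → i < 48 → P (m + i)) →
                        (∀ x → m ≤ x → P x → P (48 + x)) → ∀ x → m ≤ x → P x
period-induction-from P m start step x m≤x =
  subst P (m+[n∸m]≡n m≤x) (<-rec (λ y → P (m + y)) go (x ∸ m))
  where
  go : ∀ y → (∀ {z} → z < y → P (m + z)) → P (m + y)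
  go y rec with y <? 48
  ... | yes y<48 = start y y<48
  ... | no  y≮48 = subst P eq (step (m + z) (m≤m+n m z) (rec z<y))
    where
    z : ℕ
    z = y ∸ 48
    y≡48+z : 48 + z ≡ y
    y≡48+z = m+[n∸m]≡n (≮⇒≥ y≮48)
    z<y : z < y
    z<y = subst (z <_) y≡48+z (m≤n+m (suc z) 47)
    eq : 48 + (m + z) ≡ m + y
    eq = begin
      48 + (m + z)   ≡⟨ +-assoc 48 m z ⟨
      48 + m + z     ≡⟨ cong (_+ z) (+-comm 48 m) ⟩
      m + 48 + z     ≡⟨ +-assoc m 48 z ⟩
      m + (48 + z)   ≡⟨ cong (m +_) y≡48+z ⟩
      m + y          ∎
      where open ≡-Reasoning

period-induction : ∀ {p} (P : ℕ → Set p) m → (∀ x → x < m + 48 → P x) →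
                   (∀ x → m ≤ x → P x → P (48 + x)) → ∀ x → P x
period-induction P m start step x with x <? m
... | yes x<m = start x (<-≤-trans x<m (m≤m+n m 48))
... | no  x≮m =
  period-induction-from P m (λ i i<48 → start (m + i) (+-monoʳ-< m i<48)) step x (≮⇒≥ x≮m)

-- Displacement and phase of partners.

Near : Bool → ℕ → ℕ → Set
Near τ c x = partner τ c x ≤ 9 + x × x ≤ 9 + partner τ c x

-- The bound 9 is attained: `prefix 7` pairs 0 with 9. The range ends at 112 = 64 + 48, one period
-- beyond the longest prefix.
near-check : ∀ c → c < 10 → ∀ x → x < 112 → ∀ τ → Near τ c x
near-check = from-yes (all<? (λ c → all<? (λ x → allBool? (λ τ →
  partner τ c x ≤? 9 + x ×-dec x ≤? 9 + partner τ c x)) 112) 10)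

partner-near : ∀ τ c → c < 10 → ∀ x → Near τ c x
partner-near τ c c<10 = period-induction (Near τ c) 64 (λ x x<112 → near-check c c<10 x x<112 τ) step
  where
  step : ∀ y → 64 ≤ y → Near τ c y → Near τ c (48 + y)
  step y 64≤y (p , q) rewrite partner-shift τ c c<10 y 64≤y = +-monoʳ-≤ 48 p , +-monoʳ-≤ 48 q

[48+n]/4 : ∀ n → (48 + n) / 4 ≡ 12 + n / 4
[48+n]/4 n = +-distrib-/-∣ˡ {48} n {4} (divides 12 refl)

quad-check : ∀ c → c < 4 → ∀ i → i < 48 → ∀ τ → partner τ c (64 + i) / 4 ≡ (64 + i) / 4
quad-check = from-yes (all<? (λ c → all<? (λ i → allBool? (λ τ →
  partner τ c (64 + i) / 4 ≟ (64 + i) / 4)) 48) 4)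

-- For `c < 4` the prefix has length 32 and the blocks length 4, so each block is an aligned
-- quadruple. With `phase-cong` this gives partners the same phase.
partner-/4 : ∀ τ c → c < 4 → ∀ x → 64 ≤ x → partner τ c x / 4 ≡ x / 4
partner-/4 τ c c<4 =
  period-induction-from (λ x → partner τ c x / 4 ≡ x / 4) 64 (λ i i<48 → quad-check c c<4 i i<48 τ) step
  where
  step : ∀ y → 64 ≤ y → partner τ c y / 4 ≡ y / 4 → partner τ c (48 + y) / 4 ≡ (48 + y) / 4
  step y 64≤y q
    rewrite partner-shift τ c (<-≤-trans c<4 (from-yes (4 ≤? 10))) y 64≤y
          | [48+n]/4 (partner τ c y) | [48+n]/4 y = cong (12 +_) q

block-late : ∀ c → 4 ≤ c → ∀ τ τ′ → block c τ ≡ block c τ′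
block-late 0 () _ _
block-late 1 (s≤s ()) _ _
block-late 2 (s≤s (s≤s ())) _ _
block-late 3 (s≤s (s≤s (s≤s ()))) _ _
block-late 4 _ _ _ = refl
block-late 5 _ _ _ = refl
block-late 6 _ _ _ = refl
block-late 7 _ _ _ = refl
block-late 8 _ _ _ = refl
block-late 9 _ _ _ = refl
block-late (suc (suc (suc (suc (suc (suc (suc (suc (suc (suc _)))))))))) _ _ _ = refl

φ≡partner : ∀ τ c x → (c < 4 → phase x ≡ τ) → φ c x ≡ partner τ c x
φ≡partner τ c x eq with c <? 4
... | yes c<4 = cong (λ σ → partner σ c x) (eq c<4)
... | no  c≮4 = cong (λ bs → extend (prefix c) bs x) (block-late c (≮⇒≥ c≮4) (phase x) τ)

-- Since 28 = 4 * 7, the phase cannot change inside an aligned quadruple.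
phase-cong : ∀ x y → x / 4 ≡ y / 4 → phase x ≡ phase y
phase-cong x y eq = cong (λ n → odd ⌈log₂ suc n ⌉) (begin
  x / 28       ≡⟨ m/n/o≡m/[n*o] x 4 7 ⟨
  x / 4 / 7    ≡⟨ cong (_/ 7) eq ⟩
  y / 4 / 7    ≡⟨ m/n/o≡m/[n*o] y 4 7 ⟩
  y / 28       ∎)
  where open ≡-Reasoning

⌊n/2⌋≡n/2 : ∀ n → ⌊ n /2⌋ ≡ n / 2
⌊n/2⌋≡n/2 zero          = refl
⌊n/2⌋≡n/2 (suc zero)    = refl
⌊n/2⌋≡n/2 (suc (suc n)) =
  trans (cong suc (⌊n/2⌋≡n/2 n)) (sym (+-distrib-/-∣ˡ {2} n {2} (divides 1 refl)))

-- Halving `x` halves `x / 28`, which lowers the logarithm by one; `28 ≤ x` makes the logarithm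
-- positive, so the predecessor is not truncated.
phase-half : ∀ x → 28 ≤ x → phase ⌊ x /2⌋ ≡ not (phase x)
phase-half x 28≤x = begin
  odd ⌈log₂ suc (⌊ x /2⌋ / 28) ⌉        ≡⟨ cong (λ n → odd ⌈log₂ suc n ⌉) half/28 ⟩
  -- `suc ⌊ m /2⌋` and `⌈ suc m /2⌉` are definitionally equal.
  odd ⌈log₂ ⌈ suc m /2⌉ ⌉               ≡⟨ cong odd (⌈log₂⌈n/2⌉⌉≡⌈log₂n⌉∸1 (suc m)) ⟩
  odd (⌈log₂ suc m ⌉ ∸ 1)               ≡⟨ odd-pred (⌈log₂⌉-mono-≤ {2} (s≤s 1≤m)) ⟩
  not (odd ⌈log₂ suc m ⌉)               ∎
  where
  open ≡-Reasoning
  m : ℕ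
  m = x / 28
  1≤m : 1 ≤ m
  1≤m = /-monoˡ-≤ 28 28≤x
  half/28 : ⌊ x /2⌋ / 28 ≡ ⌊ m /2⌋
  half/28 = begin
    ⌊ x /2⌋ / 28   ≡⟨ cong (_/ 28) (⌊n/2⌋≡n/2 x) ⟩
    x / 2 / 28     ≡⟨ m/n/o≡m/[n*o] x 2 28 ⟩
    x / 56         ≡⟨ m/n/o≡m/[n*o] x 28 2 ⟨
    m / 2          ≡⟨ ⌊n/2⌋≡n/2 m ⟨
    ⌊ m /2⌋        ∎
  odd-pred : ∀ {n} → 1 ≤ n → odd (n ∸ 1) ≡ not (odd n)
  odd-pred {suc n} _ = sym (not-involutive (odd n))

-- The kernel conditions for all `a`.

kernel-shift : ∀ τ c → c < 10 → ∀ a → 80 ≤ a →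
  Kernel (partner τ) (partner (not τ)) c a → Kernel (partner τ) (partner (not τ)) c (48 + a)
kernel-shift τ c c<10 a 80≤a K = kernel
  (trans (cong (f c) (f-shift c c<10 64≤a))
    (trans (f-shift c c<10 64≤fca) (cong (48 +_) (involutive K))))
  (λ c′ c′<c eq → distinct K c′ c′<c (+-cancelˡ-≡ 48 _ _
    (trans (sym (f-shift c′ (<-trans c′<c c<10) 64≤a)) (trans eq (f-shift c c<10 64≤a)))))
  -- `⌊ 48 + n /2⌋` computes to `24 + ⌊ n /2⌋`, so the shift to cancel is 24.
  (λ _ eq → unhalved K (here (≤-trans (s≤s z≤n) 80≤a)) (+-cancelˡ-≡ 24 _ _
    (trans (sym (cong ⌊_/2⌋ (f-shift c c<10 64≤a))) (trans eq g-shift))))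
  absorb
  where
  f g : ℕ → ℕ → ℕ
  f = partner τ
  g = partner (not τ)
  64≤a : 64 ≤ a
  64≤a = ≤-trans (from-yes (64 ≤? 80)) 80≤a
  64≤fca : 64 ≤ f c a
  -- 73 = 64 + 9: the partner is at most 9 below `a`.
  64≤fca = +-cancelˡ-≤ 9 _ _ (≤-trans (from-yes (73 ≤? 80))
    (≤-trans 80≤a (proj₂ (partner-near τ c c<10 a))))
  f-shift : ∀ c → c < 10 → ∀ {x} → 64 ≤ x → f c (48 + x) ≡ 48 + f c x
  f-shift c c<10 {x} = partner-shift τ c c<10 x
  g-shift : g ⌊ c /2⌋ (24 + ⌊ a /2⌋) ≡ 24 + g ⌊ c /2⌋ ⌊ a /2⌋
  g-shift = partner-half-shift (not τ) c c<10 ⌊ a /2⌋ (⌊n/2⌋-mono 64≤a)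
  -- Keeping `b` a variable lets `refl` put the shifted form of the window everywhere at once.
  absorb′ : ∀ d → d < 19 → ∀ {b} → b ≡ 48 + (9 + a ∸ d) → b < f c (48 + a) → 48 + a < f c b →
            Absorbed f g c (48 + a) b
  absorb′ d d<19 refl p q = case absorbing K d d<19
      (+-cancelˡ-< 48 _ _ (<-≤-trans p (≤-reflexive (f-shift c c<10 64≤a))))
      (+-cancelˡ-< 48 _ _ (<-≤-trans q (≤-reflexive (f-shift c c<10 64≤b)))) of λ where
      (inj₁ (c′ , c′<c , eq)) →
        inj₁ (c′ , c′<c , trans (f-shift c′ (<-trans c′<c c<10) 64≤a) (cong (48 +_) eq))
      (inj₂ eq) → inj₂ (trans (cong (24 +_) eq) (sym g-shift))
    where
    64≤b : 64 ≤ 9 + a ∸ d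
    -- 71 = 89 ∸ 18 is the least number in the window of any `a` from 80 on.
    64≤b = ≤-trans (from-yes (64 ≤? 71)) (∸-mono (+-monoʳ-≤ 9 80≤a) (s≤s⁻¹ d<19))
  absorb : ∀ d → d < 19 → 9 + (48 + a) ∸ d < f c (48 + a) → 48 + a < f c (9 + (48 + a) ∸ d) →
           Absorbed f g c (48 + a) (9 + (48 + a) ∸ d)
  absorb d d<19 = absorb′ d d<19 (+-∸-assoc 48
    (≤-trans (s≤s⁻¹ d<19) (≤-trans (from-yes (18 ≤? 89)) (+-monoʳ-≤ 9 80≤a))))

partner-kernel : ∀ τ c → c < 10 → ∀ a → 80 ≤ a → Kernel (partner τ) (partner (not τ)) c a
partner-kernel τ c c<10 = period-induction-from (Kernel (partner τ) (partner (not τ)) c) 80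
  (λ i i<48 → periodic-kernel c c<10 i i<48 τ) (kernel-shift τ c c<10)

-- For large `a`, all numbers compared before halving may be given the phase `τ` of `a`, and
-- `⌊ a /2⌋` has the opposite one, so `φ` can be replaced by `partner τ` and `partner (not τ)`.
φ-kernel : ∀ c → c < 10 → ∀ a → Kernel φ φ c a
φ-kernel c c<10 a with a <? 80
... | yes a<80 = initial-kernel c c<10 a a<80
... | no  a≮80 = kernel
  (trans (φ≡partner τ c (φ c a) (λ c<4 → phase-cong (φ c a) a (partner-/4 τ c c<4 a 64≤a))) (involutive K))
  -- Both sides are evaluated at `a`, where `φ` is `partner τ` by definition.
  (distinct K)
  (λ nz eq → unhalved K nz (trans eq halved))
  absorb
  where
  τ : Bool
  τ = phase a
  80≤a : 80 ≤ a
  80≤a = ≮⇒≥ a≮80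
  64≤a : 64 ≤ a
  64≤a = ≤-trans (from-yes (64 ≤? 80)) 80≤a
  K : Kernel (partner τ) (partner (not τ)) c a
  K = partner-kernel τ c c<10 a 80≤a
  halved : φ ⌊ c /2⌋ ⌊ a /2⌋ ≡ partner (not τ) ⌊ c /2⌋ ⌊ a /2⌋
  halved = φ≡partner (not τ) ⌊ c /2⌋ ⌊ a /2⌋ (λ _ →
    phase-half a (≤-trans (from-yes (28 ≤? 80)) 80≤a))
  absorb : ∀ d → d < 19 → 9 + a ∸ d < φ c a → a < φ c (9 + a ∸ d) → Absorbed φ φ c a (9 + a ∸ d)
  absorb d d<19 b<φca a<φcb = case absorbing K d d<19 b<φca (subst (a <_) φcb a<φcb) of λ where
      (inj₁ e)  → inj₁ e
      (inj₂ eq) → inj₂ (trans eq (sym halved))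
    where
    b : ℕ
    b = 9 + a ∸ d
    64≤b : 64 ≤ b
    64≤b = ≤-trans (from-yes (64 ≤? 71)) (∸-mono (+-monoʳ-≤ 9 80≤a) (s≤s⁻¹ d<19))
    φcb : φ c b ≡ partner τ c b
    -- The two strict inequalities force `a` and `b` into one quadruple: `b` is below the partner of
    -- `a`, which shares the quadruple of `a`, and symmetrically.
    φcb = φ≡partner τ c b λ c<4 → phase-cong b a (≤-antisym
      (≤-trans (/-monoˡ-≤ 4 (<⇒≤ b<φca)) (≤-reflexive (partner-/4 τ c c<4 a 64≤a)))
      (≤-trans (/-monoˡ-≤ 4 (<⇒≤ a<φcb)) (≤-reflexive (partner-/4 (phase b) c c<4 b 64≤b))))

-- Displacement at most 9 confines `b` to the finite window of `absorbing`, at the index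
-- `d = 9 + a ∸ b`.
φ-absorbing : ∀ c → c < 10 → ∀ a b → b < φ c a → a < φ c b → Absorbed φ φ c a b
φ-absorbing c c<10 a b b<φca a<φcb =
  subst Abs window (absorbing (φ-kernel c c<10 a) d d<19
    (subst (_< φ c a) (sym window) b<φca) (subst (λ y → a < φ c y) (sym window) a<φcb))
  where
  Abs : ℕ → Set
  Abs = Absorbed φ φ c a
  d : ℕ
  d = 9 + a ∸ b
  b≤9+a : b ≤ 9 + a
  b≤9+a = ≤-trans (<⇒≤ b<φca) (proj₁ (partner-near (phase a) c c<10 a))
  a≤8+b : a ≤ 8 + b
  a≤8+b = s≤s⁻¹ (≤-trans a<φcb (proj₁ (partner-near (phase b) c c<10 b)))
  window : 9 + a ∸ d ≡ b
  window = m∸[m∸n]≡n b≤9+a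
  d<19 : d < 19
  d<19 = s≤s (≤-trans (∸-monoˡ-≤ b (+-monoʳ-≤ 9 a≤8+b))
              (≤-trans (≤-reflexive (m+n∸n≡m 17 b)) (from-yes (17 ≤? 18))))

-- From the kernel to winning strategies.

sum-⌊/2⌋-≤ : ∀ ps → sum (map ⌊_/2⌋ ps) ≤ sum ps
sum-⌊/2⌋-≤ []       = z≤n
sum-⌊/2⌋-≤ (n ∷ ps) = +-mono-≤ (⌊n/2⌋≤n n) (sum-⌊/2⌋-≤ ps)

sum-⌊/2⌋-< : ∀ {ps} → Any (0 <_) ps → sum (map ⌊_/2⌋ ps) < sum ps
sum-⌊/2⌋-< {suc n ∷ ps} (here _)  = +-mono-<-≤ (⌊n/2⌋<n n) (sum-⌊/2⌋-≤ ps)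
sum-⌊/2⌋-< {n ∷ ps}     (there p) = +-mono-≤-< (⌊n/2⌋≤n n) (sum-⌊/2⌋-< p)

⟶ᵖ-sum : ∀ {ps qs} → ps ⟶ᵖ qs → sum qs < sum ps
⟶ᵖ-sum {_ ∷ ps} (here m<n)  = +-monoˡ-< (sum ps) m<n
⟶ᵖ-sum {n ∷ _}  (there mv) = +-monoʳ-< n (⟶ᵖ-sum mv)

⟶-sum : ∀ {ps qs} → ps ⟶ qs → sum qs < sum ps
⟶-sum (remove mv) = ⟶ᵖ-sum mv
⟶-sum (halve nz)  = sum-⌊/2⌋-< nz

-- Playing the two strategies against each other would never end, but strategies are well founded.
𝒫-𝒩-disjoint : ∀ {ps} → 𝒫-position ps → 𝒩-position ps → ⊥
𝒫-𝒩-disjoint (every-move f) (some-move mv p) = 𝒫-𝒩-disjoint p (f mv)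

Outcome : ℕ → ℕ → ℕ → Set
Outcome a b c = (b ≡ φ c a → 𝒫-position (a ∷ b ∷ c ∷ [])) ×
                (b ≢ φ c a → 𝒩-position (a ∷ b ∷ c ∷ []))

φ-involutive : ∀ c → c < 10 → ∀ a → φ c (φ c a) ≡ a
φ-involutive c c<10 a = involutive (φ-kernel c c<10 a)

nonempty : ∀ a b c → b < φ c a → Any (0 <_) (a ∷ b ∷ c ∷ [])
nonempty (suc _) _       _       _ = here z<s
nonempty zero    (suc _) _       _ = there (here z<s)
nonempty zero    zero    (suc _) _ = there (there (here z<s))
-- `φ 0 0` computes to 0.
nonempty zero    zero    zero    ()

-- Induction on a bound for the number of coins. Both outcomes are built together, as each uses the
-- other after a move; the third pile never grows, so `c < 10` persists.
outcome : ∀ n a b c → sum (a ∷ b ∷ c ∷ []) < n → c < 10 → Outcome a b c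
outcome (suc n) a b c <n c<10 = 𝒫-case , 𝒩-case
  where
  rec : ∀ {a′ b′ c′} → (a ∷ b ∷ c ∷ []) ⟶ (a′ ∷ b′ ∷ c′ ∷ []) → c′ < 10 → Outcome a′ b′ c′
  rec mv = outcome n _ _ _ (<-≤-trans (⟶-sum mv) (s≤s⁻¹ <n))

  𝒫-case : b ≡ φ c a → 𝒫-position (a ∷ b ∷ c ∷ [])
  𝒫-case refl = every-move λ where
    -- An involution is injective, so `a′` and `a` cannot share the partner `b`.
    mv@(remove (here {m = a′} a′<a)) → proj₂ (rec mv c<10) λ eq → <⇒≢ a′<a
      (trans (sym (φ-involutive c c<10 a′)) (trans (cong (φ c) (sym eq)) (φ-involutive c c<10 a)))
    mv@(remove (there (here b′<b))) → proj₂ (rec mv c<10) (<⇒≢ b′<b)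
    mv@(remove (there (there (here {m = c′} c′<c)))) → proj₂ (rec mv (<-trans c′<c c<10))
      λ eq → distinct (φ-kernel c c<10 a) c′ c′<c (sym eq)
    (remove (there (there (there ()))))
    mv@(halve nz) → proj₂ (rec mv (⌊c/2⌋<10 c<10)) (unhalved (φ-kernel c c<10 a) nz)

  𝒩-case : b ≢ φ c a → 𝒩-position (a ∷ b ∷ c ∷ [])
  𝒩-case b≢φca with <-cmp b (φ c a) | <-cmp a (φ c b)
  ... | tri≈ _ b≡φca _ | _ = contradiction b≡φca b≢φca
  ... | tri> _ _ φca<b | _ = some-move mv (proj₁ (rec mv c<10) refl)
    where mv = remove (there (here φca<b))
  ... | _ | tri≈ _ a≡φcb _ =
    contradiction (trans (sym (φ-involutive c c<10 b)) (cong (φ c) (sym a≡φcb))) b≢φca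
  ... | _ | tri> _ _ φcb<a = some-move mv (proj₁ (rec mv c<10) (sym (φ-involutive c c<10 b)))
    where mv = remove (here φcb<a)
  -- Neither of the first two piles can be lowered to the partner of the other; there remain the
  -- third pile and halving.
  ... | tri< b<φca _ _ | tri< a<φcb _ _ = case φ-absorbing c c<10 a b b<φca a<φcb of λ where
    (inj₁ (c′ , c′<c , eq)) → let mv = remove (there (there (here c′<c))) in
      some-move mv (proj₁ (rec mv (<-trans c′<c c<10)) (sym eq))
    (inj₂ eq) → let mv = halve (nonempty a b c b<φca) in
      some-move mv (proj₁ (rec mv (⌊c/2⌋<10 c<10)) eq)

-- XOR with 7, and the identification of `φ 9` with `φ₉`.

xorDigits-zeroʳ : ∀ {k x} → x ≤ k → xorDigits k x 0 ≡ x
xorDigits-zeroʳ {zero}  {zero} _ = refl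
xorDigits-zeroʳ {suc k} {x} x≤1+k = begin
  (x % 2 + 0) % 2 + 2 * xorDigits k (x / 2) 0
    ≡⟨ cong₂ (λ d e → d % 2 + 2 * e) (+-identityʳ (x % 2)) (xorDigits-zeroʳ (x/2≤k x x≤1+k)) ⟩
  x % 2 % 2 + 2 * (x / 2)                      ≡⟨ cong₂ _+_ (m%n%n≡m%n x 2) (*-comm 2 (x / 2)) ⟩
  x % 2 + x / 2 * 2                            ≡⟨ m≡m%n+[m/n]*n x 2 ⟨
  x                                            ∎
  where
  open ≡-Reasoning
  x/2≤k : ∀ x → x ≤ suc k → x / 2 ≤ k
  x/2≤k zero    _ = z≤n
  x/2≤k (suc x) p = s≤s⁻¹ (≤-trans (m/n<m (suc x) 2 (s≤s (s≤s z≤n))) p)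

-- An even summand leaves the lowest digit alone, so the claim passes to the halves. The digit
-- counts `k` and `j` differ because `_⊕_` chooses its count from its arguments.
xorDigits-shift : ∀ m k j x y →
  xorDigits k (m + x / 2) (y / 2) ≡ m + xorDigits j (x / 2) (y / 2) →
  xorDigits (suc k) (2 * m + x) y ≡ 2 * m + xorDigits (suc j) x y
xorDigits-shift m k j x y eq = begin
  ((2 * m + x) % 2 + y % 2) % 2 + 2 * xorDigits k ((2 * m + x) / 2) (y / 2)
    ≡⟨ cong₂ (λ d z → (d + y % 2) % 2 + 2 * xorDigits k z (y / 2))
         (%-remove-+ˡ x (m∣m*n m)) [2m+x]/2 ⟩
  d + 2 * xorDigits k (m + x / 2) (y / 2)
    ≡⟨ cong (λ z → d + 2 * z) eq ⟩
  d + 2 * (m + e)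
    ≡⟨ solve 3 (λ d m e → d :+ con 2 :* (m :+ e) := con 2 :* m :+ (d :+ con 2 :* e)) refl d m e ⟩
  2 * m + (d + 2 * e) ∎
  where
  open ≡-Reasoning
  open +-*-Solver
  d e : ℕ
  d = (x % 2 + y % 2) % 2
  e = xorDigits j (x / 2) (y / 2)
  [2m+x]/2 : (2 * m + x) / 2 ≡ m + x / 2
  [2m+x]/2 = trans (+-distrib-/-∣ˡ x (m∣m*n m))
    (cong (_+ x / 2) (trans (cong (_/ 2) (*-comm 2 m)) (m*n/n≡m m 2)))

-- A multiple of 8 does not affect the three digits occupied by 7; above them the XOR is with 0.
⊕7-shift : ∀ n x → 8 ∣ n → (n + x) ⊕ 7 ≡ n + (x ⊕ 7)
-- With 7 in front, the digit counts expose the three successors that `low-digits` peels off.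
⊕7-shift n@.(q * 8) x (divides-refl q) rewrite +-comm (n + x) 7 | +-comm x 7 =
  subst (λ n → ∀ {k} → q + x ≤ k → xorDigits (3 + k) (n + x) 7 ≡ n + xorDigits (7 + x) x 7)
    2*2*2*q≡q*8 low-digits
    (m≤n⇒m≤o+n 4 (+-monoˡ-≤ x (m≤m*n q 8)))
  where
  2*2*2*q≡q*8 : 2 * (2 * (2 * q)) ≡ q * 8
  2*2*2*q≡q*8 = solve 1 (λ q → con 2 :* (con 2 :* (con 2 :* q)) := q :* con 8) refl q
    where open +-*-Solver
  x/8≤x : x / 2 / 2 / 2 ≤ x
  x/8≤x = ≤-trans (m/n≤m (x / 2 / 2) 2) (≤-trans (m/n≤m (x / 2) 2) (m/n≤m x 2))
  low-digits : ∀ {k} → q + x ≤ k →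
               xorDigits (3 + k) (2 * (2 * (2 * q)) + x) 7 ≡ 2 * (2 * (2 * q)) + xorDigits (7 + x) x 7
  low-digits {k} q+x≤k =
    xorDigits-shift (2 * (2 * q)) (2 + k) (6 + x) x 7
      (xorDigits-shift (2 * q) (1 + k) (5 + x) (x / 2) 3
        (xorDigits-shift q k (4 + x) (x / 2 / 2) 1
          (trans (xorDigits-zeroʳ (≤-trans (+-monoʳ-≤ q x/8≤x) q+x≤k))
            (cong (q +_) (sym (xorDigits-zeroʳ (m≤n⇒m≤o+n 4 x/8≤x)))))))

φ₉-late : ∀ x → 64 ≤ x → φ₉ x ≡ x ⊕[ lookup S₉ ((x ∸ 64) mod 24) ] 7
φ₉-late x 64≤x with x <? 64
... | yes x<64 = contradiction 64≤x (<⇒≱ x<64)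
... | no  _    = refl

φ₉-shift : ∀ n x → 24 ∣ n → 64 ≤ x → φ₉ (n + x) ≡ n + φ₉ x
-- Adding `s` to both sides undoes the truncated subtraction, by `⊕[]-exact`.
φ₉-shift n x 24∣n 64≤x = +-cancelʳ-≡ s _ _ (begin
  φ₉ (n + x) + s             ≡⟨ cong (_+ s) φ₉[n+x] ⟩
  (n + x) ⊕[ s ] 7 + s       ≡⟨ ⊕[]-exact s (m≤n⇒m≤o+n n 7≤x) ⟩
  (n + x + s) ⊕ 7            ≡⟨ cong (_⊕ 7) (+-assoc n x s) ⟩
  (n + (x + s)) ⊕ 7          ≡⟨ ⊕7-shift n (x + s) (∣-trans (divides 3 refl) 24∣n) ⟩
  n + ((x + s) ⊕ 7)          ≡⟨ cong (n +_) (⊕[]-exact s 7≤x) ⟨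
  n + (x ⊕[ s ] 7 + s)       ≡⟨ cong (λ z → n + (z + s)) (φ₉-late x 64≤x) ⟨
  n + (φ₉ x + s)             ≡⟨ +-assoc n (φ₉ x) s ⟨
  n + φ₉ x + s               ∎)
  where
  open ≡-Reasoning
  s : ℕ
  s = lookup S₉ ((x ∸ 64) mod 24)
  7≤x : 7 ≤ x
  7≤x = ≤-trans (from-yes (7 ≤? 64)) 64≤x
  [n+x∸64]%24 : (n + x ∸ 64) % 24 ≡ (x ∸ 64) % 24
  [n+x∸64]%24 = trans (cong (_% 24) (+-∸-assoc n 64≤x)) (%-remove-+ˡ (x ∸ 64) 24∣n)
  φ₉[n+x] : φ₉ (n + x) ≡ (n + x) ⊕[ s ] 7
  φ₉[n+x] = trans (φ₉-late (n + x) (m≤n⇒m≤o+n n 64≤x))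
    (cong (λ i → (n + x) ⊕[ lookup S₉ i ] 7) (fromℕ<-cong _ _ [n+x∸64]%24 _ _))

φ₉-check : ∀ x → x < 112 → φ 9 x ≡ φ₉ x
φ₉-check = from-yes (all<? (λ x → φ 9 x ≟ φ₉ x) 112)

-- `φ 9` repeats with period 12 and XOR with 7 with period 8. The shifts in `S₉` reconcile them: 12
-- places on they change by 4, so `x + s` moves by 8 or 16.
φ9≡φ₉ : ∀ x → φ 9 x ≡ φ₉ x
φ9≡φ₉ = period-induction (λ x → φ 9 x ≡ φ₉ x) 64 φ₉-check step
  where
  step : ∀ y → 64 ≤ y → φ 9 y ≡ φ₉ y → φ 9 (48 + y) ≡ φ₉ (48 + y)
  step y 64≤y eq = begin
    -- `block 9` ignores the phase, so `phase (48 + y)` may silently become `phase y`.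
    partner (phase (48 + y)) 9 (48 + y)   ≡⟨ partner-shift (phase (48 + y)) 9 ≤-refl y 64≤y ⟩
    48 + φ 9 y                            ≡⟨ cong (48 +_) eq ⟩
    48 + φ₉ y                             ≡⟨ φ₉-shift 48 y (divides 2 refl) 64≤y ⟨
    φ₉ (48 + y)                           ∎
    where open ≡-Reasoning

theorem40 : (a b : ℕ) → 𝒫-position (a ∷ b ∷ 9 ∷ []) ⇔ b ≡ φ₉ a
theorem40 a b = mk⇔ to (λ eq → proj₁ verdict (trans eq (sym (φ9≡φ₉ a))))
  where
  verdict : Outcome a b 9
  verdict = outcome (suc (sum (a ∷ b ∷ 9 ∷ []))) a b 9 ≤-refl ≤-refl
  to : 𝒫-position (a ∷ b ∷ 9 ∷ []) → b ≡ φ₉ a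
  to p with b ≟ φ 9 a
  ... | yes b≡φa = trans b≡φa (φ9≡φ₉ a)
  ... | no  b≢φa = contradiction (proj₂ verdict b≢φa) (𝒫-𝒩-disjoint p)
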